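{- Let $n\ge 1$ and let $G$ be a simple undirected graph with vertex set $[n]=\{1,\dots,n\}$. Then there are poset isomorphisms $$\mathcal L(\mathcal H_{2n-3}(G))\cong\mathcal L(\mathcal A_{\Gamma_G})\cong\Pi_{\Gamma_G}.$$
   Context: Homogenized graphical Shi arrangement: $\mathcal H_{2n-3}(G)$ is the hyperplane arrangement in $\mathbb R^{2n-1}$ with coordinates $(x_1,\dots,x_n,y_1,\dots,y_{n-1})$ consisting of the hyperplanes $x_i-x_j=0$ for $i<j$, $\{i,j\}\in E(G)$, and $x_i-x_j=y_i$ for $1\le i<j\le n$. The graph $\Gamma_G$ has vertex set $\{1,3,\dots,2n-1\}\sqcup\{2,4,\dots,2n-2\}=[2n-1]$ and the following edges: $\{2n-2i+1,2n-2j+1\}$ for each edge $\{i,j\}\in E(G)$; and $\{2i-1,2j\}$ whenever $1\le i\le j\le n-1$. $\mathcal A_{\Gamma_G}$ is the graphical arrangement of $\Gamma_G$ in $\mathbb R^{2n-1}$: the hyperplanes $z_u=z_v$ for $\{u,v\}\in E(\Gamma_G)$. For an arrangement $\mathcal A$, $\mathcal L(\mathcal A)$ is the set of all nonempty intersections of hyperplanes of $\mathcal A$ (including the ambient space as the empty intersection), ordered by reverse inclusion. For a finite graph $\Gamma=(V,E)$, the bond lattice $\Pi_\Gamma$ is the poset of set partitions of $V$ all of whose blocks induce connected subgraphs of $\Gamma$, ordered by $\pi\le\pi'$ iff every block of $\pi$ is contained in a block of $\pi'$. -}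

module Defs where

open import Data.Fin.Base using (Fin; toℕ; inject≤; _↑ˡ_; _↑ʳ_)
import Data.Fin.Base as Fin
import Data.Fin.Properties as Fin
open import Data.Fin.Subset using (Subset; _∈_; _⊆_; Nonempty)
open import Data.Fin.Subset.Properties using (⊆-refl; ⊆-trans; ⊆-antisym)
open import Data.List.Base using (List)
open import Data.List.Relation.Unary.All using (All)
open import Data.Nat.Base using (ℕ; suc; _⊔_; _≥_)
import Data.Nat.Base as ℕ
import Data.Nat.Properties as ℕ
open import Data.Product.Base using (Σ-syntax; ∃-syntax; _×_; _,_)
open import Data.Rational.Base using (ℚ; 0ℚ; ½; ∣_∣; _<_)
import Data.Rational.Base as ℚ
import Data.Rational.Properties as ℚ
open import Data.Rational.Solver using (module +-*-Solver)
open import Data.Sum.Base using (inj₁; inj₂)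
open import Data.Vec.Functional using (Vector)
open import Function.Bundles using (_⇔_; mk⇔; Equivalence)
open import Level using (0ℓ) renaming (suc to lsuc; _⊔_ to _⊔ˡ_)
open import Relation.Binary.Bundles using (Poset)
open import Relation.Binary.Construct.Closure.ReflexiveTransitive using (Star)
open import Relation.Binary.Construct.Closure.Symmetric as Sym using (SymClosure; fwd; bwd)
open import Relation.Binary.Core using (Rel)
open import Relation.Binary.Definitions using (Symmetric; Irreflexive; Decidable)
open import Relation.Binary.Morphism.Structures using (IsOrderIsomorphism)
open import Relation.Binary.PropositionalEquality
  using (_≡_; refl; sym; trans; cong; subst)
open import Relation.Nullary using (¬_)
open import Relation.Nullary.Decidable using (map′; _×-dec_; _⊎-dec_)
open import Relation.Unary using (Pred; Satisfiable; _≐_)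
import Relation.Unary as Unary

-- Cauchy sequences of rationals; two of them are equal reals when their
-- difference tends to 0 (see _≈_).
record ℝ : Set where
  field
    seq    : ℕ → ℚ
    cauchy : ∀ ε → 0ℚ < ε →
             ∃[ N ] ∀ m n → m ≥ N → n ≥ N → ∣ seq m ℚ.- seq n ∣ < ε

open ℝ public

infix  4 _≈_
infixl 6 _+_ _-_
infix  8 -_

_≈_ : Rel ℝ 0ℓ
x ≈ y = ∀ ε → 0ℚ < ε → ∃[ N ] ∀ n → n ≥ N → ∣ seq x n ℚ.- seq y n ∣ < ε

fromℚ : ℚ → ℝ
fromℚ q .seq    _ = q
fromℚ q .cauchy ε 0<ε =
  0 , λ _ _ _ _ → subst (_< ε) (sym (cong ∣_∣ (ℚ.+-inverseʳ q))) 0<ε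

0ℝ : ℝ
0ℝ = fromℚ 0ℚ

private
  half-pos : ∀ {ε} → 0ℚ < ε → 0ℚ < ½ ℚ.* ε
  half-pos {ε} 0<ε =
    subst (_< ½ ℚ.* ε) (ℚ.*-zeroʳ ½) (ℚ.*-monoʳ-<-pos ½ 0<ε)

  half+half : ∀ ε → ½ ℚ.* ε ℚ.+ ½ ℚ.* ε ≡ ε
  half+half ε = trans (sym (ℚ.*-distribʳ-+ ε ½ ½)) (ℚ.*-identityˡ ε)

  interchange : ∀ a b c d →
    (a ℚ.+ b) ℚ.- (c ℚ.+ d) ≡ (a ℚ.- c) ℚ.+ (b ℚ.- d)
  interchange = solve 4
    (λ a b c d → (a :+ b) :- (c :+ d) := (a :- c) :+ (b :- d)) refl
    where open +-*-Solver

  neg-diff : ∀ a b → (ℚ.- a) ℚ.- (ℚ.- b) ≡ ℚ.- (a ℚ.- b)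
  neg-diff = solve 2 (λ a b → (:- a) :- (:- b) := :- (a :- b)) refl
    where open +-*-Solver

_+_ : ℝ → ℝ → ℝ
(x + y) .seq n = seq x n ℚ.+ seq y n
(x + y) .cauchy ε 0<ε
  with M , p ← cauchy x (½ ℚ.* ε) (half-pos 0<ε)
     | N , q ← cauchy y (½ ℚ.* ε) (half-pos 0<ε)
  = M ⊔ N , λ m n m≥ n≥ → begin-strict
      ∣ (seq x m ℚ.+ seq y m) ℚ.- (seq x n ℚ.+ seq y n) ∣
        ≡⟨ cong ∣_∣ (interchange (seq x m) (seq y m) (seq x n) (seq y n)) ⟩
      ∣ (seq x m ℚ.- seq x n) ℚ.+ (seq y m ℚ.- seq y n) ∣
        ≤⟨ ℚ.∣p+q∣≤∣p∣+∣q∣ (seq x m ℚ.- seq x n) (seq y m ℚ.- seq y n) ⟩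
      ∣ seq x m ℚ.- seq x n ∣ ℚ.+ ∣ seq y m ℚ.- seq y n ∣
        <⟨ ℚ.+-mono-< (p m n (ℕ.m⊔n≤o⇒m≤o M N m≥) (ℕ.m⊔n≤o⇒m≤o M N n≥))
                      (q m n (ℕ.m⊔n≤o⇒n≤o M N m≥) (ℕ.m⊔n≤o⇒n≤o M N n≥)) ⟩
      ½ ℚ.* ε ℚ.+ ½ ℚ.* ε
        ≡⟨ half+half ε ⟩
      ε ∎
  where open ℚ.≤-Reasoning

-_ : ℝ → ℝ
(- x) .seq n = ℚ.- seq x n
(- x) .cauchy ε 0<ε with N , p ← cauchy x ε 0<ε =
  N , λ m n m≥ n≥ → subst (_< ε)
    (sym (trans (cong ∣_∣ (neg-diff (seq x m) (seq x n)))
                (ℚ.∣-p∣≡∣p∣ (seq x m ℚ.- seq x n))))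
    (p m n m≥ n≥)

_-_ : ℝ → ℝ → ℝ
x - y = x + (- y)

-- An arrangement enters only through its hyperplanes as sets of points.
-- The index type may be any type of names for the hyperplanes; repeated
-- hyperplanes are harmless.

record Arrangement (d : ℕ) : Set₁ where
  field
    Index      : Set
    hyperplane : Index → Pred (Vector ℝ d) 0ℓ

-- The empty list gives the ambient space.
⋂ : ∀ {d} (𝒜 : Arrangement d) → List (Arrangement.Index 𝒜) → Pred (Vector ℝ d) 0ℓ
⋂ 𝒜 hs p = All (λ h → Arrangement.hyperplane 𝒜 h p) hs

record Flat {d : ℕ} (𝒜 : Arrangement d) : Set₁ where
  field
    points         : Pred (Vector ℝ d) 0ℓ
    hyperplanes    : List (Arrangement.Index 𝒜)
    isIntersection : points ≐ ⋂ 𝒜 hyperplanes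
    nonempty       : Satisfiable points

-- Flats are compared only as sets of points: the chosen list of
-- hyperplanes plays no role in equality or order.
ℒ : ∀ {d} → Arrangement d → Poset (lsuc 0ℓ) 0ℓ 0ℓ
ℒ 𝒜 = record
  { Carrier = Flat 𝒜
  ; _≈_     = λ X Y → points X ≐ points Y
  ; _≤_     = λ X Y → points Y Unary.⊆ points X
  ; isPartialOrder = record
    { isPreorder = record
      { isEquivalence = record
        { refl  = (λ p → p) , (λ p → p)
        ; sym   = λ (f , g) → g , f
        ; trans = λ (f , g) (h , k) → (λ p → h (f p)) , (λ p → g (k p))
        }
      ; reflexive = λ (_ , g) → g
      ; trans     = λ f g p → f (g p)
      }
    ; antisym = λ f g → g , f
    }
  }
  where open Flat

record Graph (n : ℕ) : Set₁ where
  field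
    Adj    : Rel (Fin n) 0ℓ
    adj?   : Decidable Adj
    symm   : Symmetric Adj
    irrefl : Irreflexive _≡_ Adj

graphical : ∀ {n} → Graph n → Arrangement n
graphical {n} Γ = record
  { Index      = Σ[ u ∈ Fin n ] Σ[ v ∈ Fin n ] Graph.Adj Γ u v
  ; hyperplane = λ (u , v , _) z → z u ≈ z v
  }

-- Any two vertices of B are joined by a walk of Γ staying inside B.
InducesConnected : ∀ {n} → Graph n → Subset n → Set
InducesConnected Γ B = ∀ {u v} → u ∈ B → v ∈ B →
  Star (λ a b → a ∈ B × b ∈ B × Graph.Adj Γ a b) u v

record SetPartition (n : ℕ) : Set₁ where
  field
    IsBlock  : Pred (Subset n) 0ℓ
    nonempty : ∀ {B} → IsBlock B → Nonempty B
    covers   : ∀ v → ∃[ B ] IsBlock B × v ∈ B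
    disjoint : ∀ {B C v} → IsBlock B → IsBlock C → v ∈ B → v ∈ C → B ≡ C

record BondPartition {n : ℕ} (Γ : Graph n) : Set₁ where
  field
    partition : SetPartition n
  open SetPartition partition public
  field
    connected : ∀ {B} → IsBlock B → InducesConnected Γ B

bondLattice : ∀ {n} → Graph n → Poset (lsuc 0ℓ) 0ℓ 0ℓ
bondLattice Γ = record
  { Carrier = BondPartition Γ
  ; _≈_     = _≈π_
  ; _≤_     = _≤π_
  ; isPartialOrder = record
    { isPreorder = record
      { isEquivalence = record
        { refl  = λ _ → mk⇔ (λ b → b) (λ b → b)
        ; sym   = λ e B → mk⇔ (from (e B)) (to (e B))
        ; trans = λ e f B → mk⇔ (λ b → to (f B) (to (e B) b))
                                (λ b → from (e B) (from (f B) b))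
        }
      ; reflexive = λ e {B} b → B , to (e B) b , ⊆-refl
      ; trans     = λ f g b →
          let C , c , B⊆C = f b
              D , d , C⊆D = g c
          in D , d , ⊆-trans B⊆C C⊆D
      }
    ; antisym = λ {π} {ρ} f g B → mk⇔ (half π ρ f g) (half ρ π g f)
    }
  }
  where
  open BondPartition
  open Equivalence

  _≈π_ _≤π_ : Rel (BondPartition Γ) 0ℓ
  π ≈π ρ = ∀ B → IsBlock π B ⇔ IsBlock ρ B
  π ≤π ρ = ∀ {B} → IsBlock π B → ∃[ C ] IsBlock ρ C × B ⊆ C

  half : ∀ π ρ → π ≤π ρ → ρ ≤π π → ∀ {B} → IsBlock π B → IsBlock ρ B
  half π ρ f g {B} b =
    let C , c , B⊆C = f b
        D , d , C⊆D = g c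
        v , v∈B     = nonempty π b
        B≡D         = disjoint π b d v∈B (C⊆D (B⊆C v∈B))
    in subst (IsBlock ρ) (⊆-antisym (subst (C ⊆_) (sym B≡D) C⊆D) B⊆C) c

-- 2n − 1
dim : ℕ → ℕ
dim n = n ℕ.+ (n ℕ.∸ 1)

-- Coordinates of ℝ^(2n-1) are ordered x₁, …, xₙ, y₁, …, yₙ₋₁.
xᶜ : ∀ n → Vector ℝ (dim n) → Fin n → ℝ
xᶜ n p i = p (i ↑ˡ (n ℕ.∸ 1))

yᶜ : ∀ n → Vector ℝ (dim n) → Fin (n ℕ.∸ 1) → ℝ
yᶜ n p i = p (n ↑ʳ i)

widen : ∀ n → Fin (n ℕ.∸ 1) → Fin n
widen n i = inject≤ i (ℕ.m∸n≤m n 1)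

-- In the second family i < j ≤ n forces i ≤ n − 1, so i is taken in
-- {1, …, n−1} to begin with.
data ℋ-Index {n : ℕ} (G : Graph n) : Set where
  edge : (i j : Fin n) → i Fin.< j → Graph.Adj G i j → ℋ-Index G
  shi  : (i : Fin (n ℕ.∸ 1)) (j : Fin n) → widen n i Fin.< j → ℋ-Index G

ℋ : ∀ {n} → Graph n → Arrangement (dim n)
ℋ {n} G = record { Index = ℋ-Index G ; hyperplane = hyp }
  where
  hyp : ℋ-Index G → Pred (Vector ℝ (dim n)) 0ℓ
  hyp (edge i j _ _) p = xᶜ n p i - xᶜ n p j ≈ 0ℝ
  hyp (shi i j _)    p = xᶜ n p (widen n i) - xᶜ n p j ≈ yᶜ n p i

-- Fin m stands for {1, …, m}; this is the 1-based name of an element.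
label : ∀ {m} → Fin m → ℕ
label i = suc (toℕ i)

data ΓEdge {n : ℕ} (G : Graph n) (u v : Fin (dim n)) : Set where
  odd-odd  : (i j : Fin n) → Graph.Adj G i j →
             label u ≡ 2 ℕ.* n ℕ.∸ 2 ℕ.* label i ℕ.+ 1 →
             label v ≡ 2 ℕ.* n ℕ.∸ 2 ℕ.* label j ℕ.+ 1 → ΓEdge G u v
  odd-even : (i j : Fin (n ℕ.∸ 1)) → i Fin.≤ j →
             label u ≡ 2 ℕ.* label i ℕ.∸ 1 →
             label v ≡ 2 ℕ.* label j → ΓEdge G u v

private
  ΓEdge? : ∀ {n} (G : Graph n) → Decidable (ΓEdge G)
  ΓEdge? {n} G u v = map′
    (λ { (inj₁ (i , j , a , p , q)) → odd-odd i j a p q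
       ; (inj₂ (i , j , a , p , q)) → odd-even i j a p q })
    (λ { (odd-odd i j a p q) → inj₁ (i , j , a , p , q)
       ; (odd-even i j a p q) → inj₂ (i , j , a , p , q) })
    (Fin.any? (λ i → Fin.any? (λ j → Graph.adj? G i j ×-dec
       (label u ℕ.≟ 2 ℕ.* n ℕ.∸ 2 ℕ.* label i ℕ.+ 1) ×-dec
       (label v ℕ.≟ 2 ℕ.* n ℕ.∸ 2 ℕ.* label j ℕ.+ 1)))
     ⊎-dec
     Fin.any? (λ i → Fin.any? (λ j → (i Fin.≤? j) ×-dec
       (label u ℕ.≟ 2 ℕ.* label i ℕ.∸ 1) ×-dec
       (label v ℕ.≟ 2 ℕ.* label j))))

  odd≢even : ∀ a b → ¬ (2 ℕ.* suc a ℕ.∸ 1 ≡ 2 ℕ.* b)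
  odd≢even a b eq = ℕ.even≢odd b a (sym (trans (sym (ℕ.+-suc a (a ℕ.+ 0))) eq))

  ΓEdge-irrefl : ∀ {n} (G : Graph n) {u} → ¬ ΓEdge G u u
  ΓEdge-irrefl {n} G (odd-odd i j a p q) = Graph.irrefl G i≡j a
    where
    bound : (k : Fin n) → 2 ℕ.* label k ℕ.≤ 2 ℕ.* n
    bound k = ℕ.*-monoʳ-≤ 2 (Fin.toℕ<n k)

    i≡j : i ≡ j
    i≡j = Fin.toℕ-injective (ℕ.suc-injective (ℕ.*-cancelˡ-≡ _ _ 2
      (ℕ.∸-cancelˡ-≡ (bound i) (bound j)
        (ℕ.+-cancelʳ-≡ 1 _ _ (trans (sym p) q)))))
  ΓEdge-irrefl G (odd-even i j _ p q) =
    odd≢even (toℕ i) (label j) (trans (sym p) q)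

Γ : ∀ {n} → Graph n → Graph (dim n)
Γ G = record
  { Adj    = SymClosure (ΓEdge G)
  ; adj?   = λ u v → map′
      (λ { (inj₁ e) → fwd e ; (inj₂ e) → bwd e })
      (λ { (fwd e) → inj₁ e ; (bwd e) → inj₂ e })
      (ΓEdge? G u v ⊎-dec ΓEdge? G v u)
  ; symm   = Sym.symmetric (ΓEdge G)
  ; irrefl = λ { refl (fwd e) → ΓEdge-irrefl G e
               ; refl (bwd e) → ΓEdge-irrefl G e }
  }

infix 4 _≅_

_≅_ : ∀ {a ℓ₁ ℓ₂ b ℓ₃ ℓ₄} → Poset a ℓ₁ ℓ₂ → Poset b ℓ₃ ℓ₄ →
      Set (a ⊔ˡ ℓ₁ ⊔ˡ ℓ₂ ⊔ˡ b ⊔ˡ ℓ₃ ⊔ˡ ℓ₄)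
P ≅ Q = Σ[ f ∈ (P.Carrier → Q.Carrier) ]
          IsOrderIsomorphism P._≈_ Q._≈_ P._≤_ Q._≤_ f
  where
  module P = Poset P
  module Q = Poset Q

{-# OPTIONS --safe #-}
module Submission where

-- The linear bijection z_{2n−2i+1} = xᵢ, z_{2n−2i} = xᵢ − yᵢ carries the
-- hyperplanes of ℋ G to those of the graphical arrangement: xᵢ − xⱼ = yᵢ turns
-- into z_{2n−2j+1} = z_{2n−2i}.  A flat of a graphical arrangement consists of
-- the points constant on the components of the subgraph of chosen edges; it
-- contains a point taking different values on different components, so the
-- flat determines these components and inclusion of flats is reverse
-- refinement.  A connected partition comes from the flat cut out by the edges
-- inside its blocks.

open import Defs
open import Algebra.Bundles using (AbelianGroup; module Group)
import Algebra.Properties.AbelianGroup as AbelianGroupProperties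
open import Data.Empty using (⊥-elim)
open import Data.Fin.Base using (Fin; toℕ; fromℕ<; opposite; splitAt; _↑ˡ_; _↑ʳ_)
import Data.Fin.Base as Fin
import Data.Fin.Properties as Fin
open import Data.Fin.Subset using (Subset; inside; _∈_)
open import Data.Fin.Subset.Properties using (⊆-antisym)
import Data.Bool.Properties as Bool
import Data.Integer.Base as ℤ
import Data.Integer.Properties as ℤ
open import Data.List.Base using (List; []; _∷_; map; concatMap; cartesianProduct; allFin)
import Data.List.Membership.Propositional as List
open import Data.List.Membership.Propositional.Properties
  using (∈-allFin; ∈-cartesianProduct⁺; ∈-concatMap⁺; ∈-map⁺)
open import Data.List.Relation.Unary.All as All using (All; []; _∷_)
import Data.List.Relation.Unary.All.Properties as All
open import Data.List.Relation.Unary.Any using (here; there)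
open import Data.Nat.Base using (ℕ; zero; suc; _≥_; _⊔_; s≤s; s≤s⁻¹)
import Data.Nat.Base as ℕ
open import Data.Nat.Coprimality as Coprimality using (1-coprimeTo)
import Data.Nat.Properties as ℕ
open import Data.Product.Base using (Σ-syntax; ∃-syntax; _×_; _,_; proj₁; proj₂)
open import Data.Rational.Base using (ℚ; 0ℚ; ½; ∣_∣; _<_; mkℚ; ↥_)
import Data.Rational.Base as ℚ
import Data.Rational.Properties as ℚ
open import Data.Rational.Solver using (module +-*-Solver)
open import Data.Sum.Base using (inj₁; inj₂; _⊎_)
open import Data.Vec.Base using (tabulate)
open import Data.Vec.Functional using (Vector)
import Data.Vec.Properties as Vec
open import Function.Base using (_∘_)
open import Function.Bundles using (_⇔_; mk⇔; Equivalence)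
open import Level using (0ℓ)
open import Relation.Binary.Bundles using (Poset)
open import Relation.Binary.Construct.Closure.Equivalence as Eq using (EqClosure)
open import Relation.Binary.Construct.Closure.ReflexiveTransitive as Star using (Star; _◅_; _◅◅_)
open import Relation.Binary.Construct.Closure.Symmetric using (SymClosure; fwd; bwd)
open import Relation.Binary.Core using (Rel)
open import Relation.Binary.Definitions using (Decidable; tri<; tri≈; tri>)
open import Relation.Binary.PropositionalEquality as ≡
  using (_≡_; _≢_; refl; cong; subst)
open import Relation.Nullary using (Dec; yes; no; does)
open import Relation.Nullary.Decidable using (_×-dec_; dec-true; decidable-stable)
open import Relation.Unary using (Pred)

-- Order isomorphisms of posets.

-- By antisymmetry `_≈_` is mutual `_≤_` in both posets, so congruence and injectivity follow from
-- preserving and reflecting the order.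
orderIso : ∀ {a ℓ₁ ℓ₂ b ℓ₃ ℓ₄} (P : Poset a ℓ₁ ℓ₂) (Q : Poset b ℓ₃ ℓ₄) →
  let module P = Poset P; module Q = Poset Q in
  (f : P.Carrier → Q.Carrier) →
  (∀ x y → x P.≤ y → f x Q.≤ f y) →
  (∀ x y → f x Q.≤ f y → x P.≤ y) →
  (∀ y → ∃[ x ] f x Q.≈ y) →
  P ≅ Q
orderIso P Q f mono cancel surj = f , record
  { isOrderMonomorphism = record
    { isOrderHomomorphism = record { cong = f-cong ; mono = mono _ _ }
    ; injective = λ e → P.antisym (cancel _ _ (Q.reflexive e))
                                  (cancel _ _ (Q.reflexive (Q.Eq.sym e)))
    ; cancel    = cancel _ _
    }
  ; surjective = λ y → let x , fx≈y = surj y in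
      x , λ z≈x → Q.Eq.trans (f-cong z≈x) fx≈y
  }
  where
  module P = Poset P
  module Q = Poset Q

  f-cong : ∀ {x y} → x P.≈ y → f x Q.≈ f y
  f-cong e = Q.antisym (mono _ _ (P.reflexive e)) (mono _ _ (P.reflexive (P.Eq.sym e)))

-- The additive group of the reals

-- `x ≈ y` unfolds to `Null` of the termwise difference, so the group laws of `ℝ` reduce to
-- identities of rationals and closure of null sequences under sum and negation.
Null : Pred (ℕ → ℚ) 0ℓ
Null f = ∀ ε → 0ℚ < ε → ∃[ N ] ∀ n → n ≥ N → ∣ f n ∣ < ε

null-resp : ∀ {f g} → (∀ n → f n ≡ g n) → Null f → Null g
null-resp f≗g null ε 0<ε with N , p ← null ε 0<ε =
  N , λ n n≥N → subst (λ q → ∣ q ∣ < ε) (f≗g n) (p n n≥N)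

null-0 : Null (λ _ → 0ℚ)
null-0 ε 0<ε = 0 , λ _ _ → 0<ε

null-neg : ∀ {f} → Null f → Null (λ n → ℚ.- f n)
null-neg {f} null ε 0<ε with N , p ← null ε 0<ε =
  N , λ n n≥N → subst (_< ε) (≡.sym (ℚ.∣-p∣≡∣p∣ (f n))) (p n n≥N)

null-+ : ∀ {f g} → Null f → Null g → Null (λ n → f n ℚ.+ g n)
null-+ {f} {g} nullᶠ nullᵍ ε 0<ε
  with M , p ← nullᶠ (½ ℚ.* ε) (ℚ.*-monoʳ-<-pos ½ 0<ε)
     | N , q ← nullᵍ (½ ℚ.* ε) (ℚ.*-monoʳ-<-pos ½ 0<ε)
  = M ⊔ N , λ n n≥ → begin-strict
      ∣ f n ℚ.+ g n ∣           ≤⟨ ℚ.∣p+q∣≤∣p∣+∣q∣ (f n) (g n) ⟩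
      ∣ f n ∣ ℚ.+ ∣ g n ∣       <⟨ ℚ.+-mono-< (p n (ℕ.m⊔n≤o⇒m≤o M N n≥))
                                              (q n (ℕ.m⊔n≤o⇒n≤o M N n≥)) ⟩
      ½ ℚ.* ε ℚ.+ ½ ℚ.* ε       ≡⟨ ℚ.*-distribʳ-+ ε ½ ½ ⟨
      (½ ℚ.+ ½) ℚ.* ε           ≡⟨ ℚ.*-identityˡ ε ⟩
      ε                         ∎
  where open ℚ.≤-Reasoning

≗⇒≈ : ∀ {x y} → (∀ n → seq x n ≡ seq y n) → x ≈ y
≗⇒≈ {x} {y} x≗y = null-resp
  (λ n → ≡.sym (≡.trans (cong (ℚ._- seq y n) (x≗y n)) (ℚ.+-inverseʳ (seq y n)))) null-0

≡⇒≈ : ∀ {x y} → x ≡ y → x ≈ y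
≡⇒≈ {x} refl = ≗⇒≈ {x} {x} (λ _ → refl)

≈-resp-≡ : ∀ {x x′ y y′} → x ≡ x′ → y ≡ y′ → x ≈ y → x′ ≈ y′
≈-resp-≡ refl refl x≈y = x≈y

ℝ-abelianGroup : AbelianGroup 0ℓ 0ℓ
ℝ-abelianGroup = record
  { Carrier = ℝ
  ; _≈_     = _≈_
  ; _∙_     = _+_
  ; ε       = 0ℝ
  ; _⁻¹     = -_
  ; isAbelianGroup = record
    { isGroup = record
      { isMonoid = record
        { isSemigroup = record
          { isMagma = record
            { isEquivalence = record
              { refl  = λ {x} → ≡⇒≈ {x} refl
              ; sym   = λ {x} {y} e → null-resp (λ n → neg-sub (seq x n) (seq y n)) (null-neg e)
              ; trans = λ {x} {y} {z} e f → null-resp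
                  (λ n → sub-+-sub (seq x n) (seq y n) (seq z n)) (null-+ e f)
              }
            ; ∙-cong = λ {x} {y} {u} {v} e f → null-resp
                (λ n → interchange (seq x n) (seq y n) (seq u n) (seq v n)) (null-+ e f)
            }
          ; assoc = λ x y z → ≗⇒≈ {(x + y) + z} {x + (y + z)}
              (λ n → ℚ.+-assoc (seq x n) (seq y n) (seq z n))
          }
        ; identity = (λ x → ≗⇒≈ {0ℝ + x} {x} (λ n → ℚ.+-identityˡ (seq x n)))
                   , (λ x → ≗⇒≈ {x + 0ℝ} {x} (λ n → ℚ.+-identityʳ (seq x n)))
        }
      ; inverse = (λ x → ≗⇒≈ {(- x) + x} {0ℝ} (λ n → ℚ.+-inverseˡ (seq x n)))
                , (λ x → ≗⇒≈ {x - x} {0ℝ} (λ n → ℚ.+-inverseʳ (seq x n)))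
      ; ⁻¹-cong = λ {x} {y} e → null-resp (λ n → neg-distrib-sub (seq x n) (seq y n)) (null-neg e)
      }
    ; comm = λ x y → ≗⇒≈ {x + y} {y + x} (λ n → ℚ.+-comm (seq x n) (seq y n))
    }
  }
  where
  open +-*-Solver

  neg-sub : ∀ a b → ℚ.- (a ℚ.- b) ≡ b ℚ.- a
  neg-sub = solve 2 (λ a b → :- (a :- b) := b :- a) refl

  sub-+-sub : ∀ a b c → (a ℚ.- b) ℚ.+ (b ℚ.- c) ≡ a ℚ.- c
  sub-+-sub = solve 3 (λ a b c → (a :- b) :+ (b :- c) := a :- c) refl

  interchange : ∀ a b c d → (a ℚ.- b) ℚ.+ (c ℚ.- d) ≡ (a ℚ.+ c) ℚ.- (b ℚ.+ d)
  interchange = solve 4 (λ a b c d → (a :- b) :+ (c :- d) := (a :+ c) :- (b :+ d)) refl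

  neg-distrib-sub : ∀ a b → ℚ.- (a ℚ.- b) ≡ (ℚ.- a) ℚ.- (ℚ.- b)
  neg-distrib-sub = solve 2 (λ a b → :- (a :- b) := (:- a) :- (:- b)) refl

-- Subtraction in an abelian group.

module Subtraction {c ℓ} (A : AbelianGroup c ℓ) where
  open AbelianGroup A renaming (_≈_ to _≋_)
  open Group group using (_//_)
  open AbelianGroupProperties A
  open import Relation.Binary.Reasoning.Setoid setoid

  x//y≈ε⇔x≈y : ∀ x y → x // y ≋ ε ⇔ x ≋ y
  x//y≈ε⇔x≈y x y = mk⇔ (x∙y⁻¹≈ε⇒x≈y x y) x≈y⇒x∙y⁻¹≈ε

  -- The involution behind both directions of the change of coordinates, where `y` is traded for
  -- `x // y`.
  x//[x//y]≈y : ∀ x y → x // (x // y) ≋ y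
  x//[x//y]≈y x y = begin
    x ∙ (x ∙ y ⁻¹) ⁻¹      ≈⟨ ∙-congˡ (⁻¹-anti-homo-∙ x (y ⁻¹)) ⟩
    x ∙ (y ⁻¹ ⁻¹ ∙ x ⁻¹)   ≈⟨ ∙-congˡ (∙-congʳ (⁻¹-involutive y)) ⟩
    x ∙ (y ∙ x ⁻¹)         ≈⟨ assoc x y (x ⁻¹) ⟨
    (x ∙ y) ∙ x ⁻¹         ≈⟨ xyx⁻¹≈y x y ⟩
    y                      ∎

  -- Turns the Shi equation xᵢ - xⱼ = yᵢ into xᵢ - yᵢ = xⱼ, an equality of two coordinates `z`.
  x//y≈z⇔x//z≈y : ∀ x y z → x // y ≋ z ⇔ x // z ≋ y
  x//y≈z⇔x//z≈y x y z = mk⇔ (swap y z) (swap z y)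
    where
    swap : ∀ y z → x // y ≋ z → x // z ≋ y
    swap y z e = trans (∙-congˡ (⁻¹-cong (sym e))) (x//[x//y]≈y x y)

  //-resp-≈ : ∀ {x x′ y y′ z z′} → x ≋ x′ → y ≋ y′ → z ≋ z′ → x // y ≋ z → x′ // y′ ≋ z′
  //-resp-≈ x≈x′ y≈y′ z≈z′ e =
    trans (∙-cong (sym x≈x′) (⁻¹-cong (sym y≈y′))) (trans e z≈z′)

open AbelianGroup ℝ-abelianGroup using ()
  renaming (refl to ≈-refl; sym to ≈-sym; trans to ≈-trans; isEquivalence to ≈-isEquivalence)
open Subtraction ℝ-abelianGroup

-- If a and b differ, ε = |a - b| is positive and the constant difference would be smaller than
-- itself. Arguing by contradiction is possible because equality of rationals is decidable.
fromℚ-injective : ∀ a b → fromℚ a ≈ fromℚ b → a ≡ b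
fromℚ-injective a b e = decidable-stable (a ℚ.≟ b) λ a≢b →
  let ∣d∣≰0 = λ ∣d∣≤0 → a≢b (p-q≡0⇒p≡q (ℚ.∣p∣≡0⇒p≡0 (a ℚ.- b)
                (ℚ.≤-antisym ∣d∣≤0 (ℚ.0≤∣p∣ (a ℚ.- b)))))
      N , p = e ∣ a ℚ.- b ∣ (ℚ.≰⇒> ∣d∣≰0)
  in ℚ.<-irrefl refl (p N ℕ.≤-refl)
  where
  open AbelianGroupProperties ℚ.+-0-abelianGroup

  p-q≡0⇒p≡q : a ℚ.- b ≡ 0ℚ → a ≡ b
  p-q≡0⇒p≡q = x∙y⁻¹≈ε⇒x≈y a b

-- Built with the constructor so that the numerator `↥_` reduces to `k`, from which injectivity is
-- read off.
ℕ⇒ℚ : ℕ → ℚ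
ℕ⇒ℚ k = mkℚ (ℤ.+ k) 0 (Coprimality.sym (1-coprimeTo k))

fromℕ-injective : ∀ k l → fromℚ (ℕ⇒ℚ k) ≈ fromℚ (ℕ⇒ℚ l) → k ≡ l
fromℕ-injective k l e = ℤ.+-injective (cong ↥_ (fromℚ-injective (ℕ⇒ℚ k) (ℕ⇒ℚ l) e))

-- Change of coordinates

infix 4 _≈ᵛ_

_≈ᵛ_ : ∀ {d} → Rel (Vector ℝ d) 0ℓ
p ≈ᵛ q = ∀ i → p i ≈ q i

-- An `Arrangement` may use predicates that tell equal reals apart, while `φ` and `ψ` below are
-- mutually inverse only up to `_≈ᵛ_`.
ExtensionalArrangement : ∀ {d} → Arrangement d → Set
ExtensionalArrangement 𝒜 = ∀ h {p q} → p ≈ᵛ q → hyperplane h p → hyperplane h q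
  where open Arrangement 𝒜

Flat-resp : ∀ {d} {𝒜 : Arrangement d} → ExtensionalArrangement 𝒜 →
            (X : Flat 𝒜) → ∀ {p q} → p ≈ᵛ q → Flat.points X p → Flat.points X q
Flat-resp ext X p≈q p∈X =
  proj₂ isIntersection (All.map (λ {h} → ext h p≈q) (proj₁ isIntersection p∈X))
  where open Flat X

module ChangeOfCoordinates
  {d e} (𝒜 : Arrangement d) (ℬ : Arrangement e)
  (𝒜-ext : ExtensionalArrangement 𝒜) (ℬ-ext : ExtensionalArrangement ℬ)
  (φ : Vector ℝ d → Vector ℝ e) (ψ : Vector ℝ e → Vector ℝ d)
  (φψ : ∀ z → φ (ψ z) ≈ᵛ z) (ψφ : ∀ p → ψ (φ p) ≈ᵛ p)
  where

  private
    module 𝒜 = Arrangement 𝒜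
    module ℬ = Arrangement ℬ

  Corresponds : 𝒜.Index → ℬ.Index → Set
  Corresponds h k = ∀ p → 𝒜.hyperplane h p ⇔ ℬ.hyperplane k (φ p)

  open Equivalence
  open Flat

  -- The image of a flat under `φ` is written as its preimage under `ψ`, and vice versa. `image`
  -- supplies the hyperplanes of a pushed-forward flat and `preimage` those of a pulled-back one;
  -- the two matchings may be chosen independently.
  ℒ-iso : (∀ h → ∃[ k ] Corresponds h k) → (∀ k → ∃[ h ] Corresponds h k) → ℒ 𝒜 ≅ ℒ ℬ
  ℒ-iso image preimage = orderIso (ℒ 𝒜) (ℒ ℬ) pushforward
    (λ X Y Y⊆X {z} → Y⊆X {ψ z})
    (λ X Y fY⊆fX {p} p∈Y → Flat-resp 𝒜-ext X (ψφ p)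
      (fY⊆fX (Flat-resp 𝒜-ext Y (ψφ˘ p) p∈Y)))
    (λ Y → pullback Y , (λ {z} → Flat-resp ℬ-ext Y (φψ z))
                      , (λ {z} → Flat-resp ℬ-ext Y (φψ˘ z)))
    where
    φψ˘ : ∀ z → z ≈ᵛ φ (ψ z)
    φψ˘ z i = ≈-sym {φ (ψ z) i} {z i} (φψ z i)

    ψφ˘ : ∀ p → p ≈ᵛ ψ (φ p)
    ψφ˘ p i = ≈-sym {ψ (φ p) i} {p i} (ψφ p i)

    pushforward : Flat 𝒜 → Flat ℬ
    pushforward X = record
      { points         = λ z → points X (ψ z)
      ; hyperplanes    = map (proj₁ ∘ image) (hyperplanes X)
      ; isIntersection =
          (λ {z} ψz∈X → All.map⁺ (All.map
            (λ {h} ψz∈h → ℬ-ext _ (φψ z) (to (proj₂ (image h) (ψ z)) ψz∈h))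
            (proj₁ (isIntersection X) ψz∈X)))
        , (λ {z} z∈⋂ → proj₂ (isIntersection X) (All.map
            (λ {h} z∈k → from (proj₂ (image h) (ψ z)) (ℬ-ext _ (φψ˘ z) z∈k))
            (All.map⁻ z∈⋂)))
      ; nonempty       = let p , p∈X = nonempty X in
          φ p , Flat-resp 𝒜-ext X (ψφ˘ p) p∈X
      }

    pullback : Flat ℬ → Flat 𝒜
    pullback Y = record
      { points         = λ p → points Y (φ p)
      ; hyperplanes    = map (proj₁ ∘ preimage) (hyperplanes Y)
      ; isIntersection =
          (λ {p} φp∈Y → All.map⁺ (All.map
            (λ {k} → from (proj₂ (preimage k) p)) (proj₁ (isIntersection Y) φp∈Y)))
        , (λ {p} p∈⋂ → proj₂ (isIntersection Y) (All.map
            (λ {k} → to (proj₂ (preimage k) p)) (All.map⁻ p∈⋂)))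
      ; nonempty       = let z , z∈Y = nonempty Y in
          ψ z , Flat-resp ℬ-ext Y (φψ˘ z) z∈Y
      }

graphical-ext : ∀ {n} (H : Graph n) → ExtensionalArrangement (graphical H)
graphical-ext H (u , v , _) {p} {q} p≈q pu≈pv =
  ≈-trans {q u} {p u} {q v} (≈-sym {p u} {q u} (p≈q u))
    (≈-trans {p u} {p v} {q v} pu≈pv (p≈q v))

-- Flats of a graphical arrangement and connected partitions

decides : ∀ {a} {A : Set a} (A? : Dec A) → does A? ≡ inside → A
decides (yes a) _ = a

fiber : ∀ {n} → (Fin n → Fin n) → Fin n → Subset n
fiber c l = tabulate (λ w → does (c w Fin.≟ l))

∈-fiber⁺ : ∀ {n} (c : Fin n → Fin n) {w l} → c w ≡ l → w ∈ fiber c l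
∈-fiber⁺ c {w} {l} cw≡l = Vec.lookup⇒[]= w (fiber c l)
  (≡.trans (Vec.lookup∘tabulate _ w) (dec-true (c w Fin.≟ l) cw≡l))

∈-fiber⁻ : ∀ {n} (c : Fin n → Fin n) {w l} → w ∈ fiber c l → c w ≡ l
∈-fiber⁻ c {w} {l} w∈ = decides (c w Fin.≟ l)
  (≡.trans (≡.sym (Vec.lookup∘tabulate _ w)) (Vec.[]=⇒lookup w∈))

module _ {n} {R : Rel (Fin n) 0ℓ} (R? : Decidable R) where

  Edge : Set
  Edge = Σ[ u ∈ Fin n ] Σ[ v ∈ Fin n ] R u v

  private
    edgeBetween : Fin n × Fin n → List Edge
    edgeBetween (u , v) with R? u v
    ... | yes r = (u , v , r) ∷ []
    ... | no _  = []

    ∈-edgeBetween : ∀ {u v} → R u v → ∃[ r ] (u , v , r) List.∈ edgeBetween (u , v)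
    ∈-edgeBetween {u} {v} r with R? u v
    ... | yes r′ = r′ , here refl
    ... | no ¬r  = ⊥-elim (¬r r)

  edges : List Edge
  edges = concatMap edgeBetween (cartesianProduct (allFin n) (allFin n))

  -- The list holds the proof produced by `R?`, which may differ from the given one; hence the
  -- existential.
  ∈-edges : ∀ {u v} → R u v → ∃[ r ] (u , v , r) List.∈ edges
  ∈-edges {u} {v} r = let r′ , r∈ = ∈-edgeBetween r in
    r′ , ∈-concatMap⁺ edgeBetween
      (List.lose (∈-cartesianProduct⁺ (∈-allFin u) (∈-allFin v)) r∈)

module GraphicalFlats {n} (H : Graph n) where
  open Graph H
  open Arrangement (graphical H) using (Index)

  Joined : List Index → Rel (Fin n) 0ℓ
  Joined hs u v = ∃[ a ] (u , v , a) List.∈ hs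

  -- Union-find: an edge redirects the representative of its first endpoint
  -- to the representative of its second one.
  redirect : Fin n → Fin n → Fin n → Fin n
  redirect a b x with x Fin.≟ a
  ... | yes _ = b
  ... | no  _ = x

  redirect-source : ∀ a b → redirect a b a ≡ b
  redirect-source a b with a Fin.≟ a
  ... | yes _   = refl
  ... | no  a≢a = ⊥-elim (a≢a refl)

  redirect-target : ∀ a b → redirect a b b ≡ b
  redirect-target a b with b Fin.≟ a
  ... | yes _ = refl
  ... | no  _ = refl

  representative : List Index → Fin n → Fin n
  representative []                w = w
  representative ((u , v , _) ∷ hs) w =
    redirect (representative hs u) (representative hs v) (representative hs w)

  -- `redirect` identifies the endpoints of the newest edge and preserves the equalities already
  -- obtained from the older ones.
  representative-joined : ∀ hs {u v} → EqClosure (Joined hs) u v →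
                          representative hs u ≡ representative hs v
  representative-joined hs = Eq.gfold ≡.isEquivalence (representative hs)
    (λ (_ , h∈hs) → All.lookup (endpoints hs) h∈hs)
    where
    endpoints : ∀ hs → All (λ (u , v , _) → representative hs u ≡ representative hs v) hs
    endpoints []                 = []
    endpoints ((u , v , _) ∷ hs) =
      ≡.trans (redirect-source (representative hs u) (representative hs v))
              (≡.sym (redirect-target (representative hs u) (representative hs v)))
      ∷ All.map (cong (redirect (representative hs u) (representative hs v))) (endpoints hs)

  joined-representative : ∀ hs w → EqClosure (Joined hs) w (representative hs w)
  joined-representative []                 w = Star.ε
  joined-representative ((u , v , a) ∷ hs) w
    with representative hs w Fin.≟ representative hs u
  ... | no  _ = Eq.map (λ (b , h∈hs) → b , there h∈hs) (joined-representative hs w)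
  -- The walk visits `w`, its old representative (shared with `u`), `u`, `v`, and the old
  -- representative of `v`, which is the new one of `w`.
  ... | yes e = weaken (joined-representative hs w)
        ◅◅ subst (λ x → EqClosure (Joined _) x u) (≡.sym e)
             (Eq.symmetric (Joined _) (weaken (joined-representative hs u)))
        ◅◅ Eq.return (a , here refl)
        ◅◅ weaken (joined-representative hs v)
    where
    weaken : ∀ {x y} → EqClosure (Joined hs) x y → EqClosure (Joined ((u , v , a) ∷ hs)) x y
    weaken = Eq.map (λ (b , h∈hs) → b , there h∈hs)

  -- Both vertices are linked to their common representative. With `representative-joined`, the
  -- classes of `representative` are exactly the components.
  joined : ∀ hs {u v} → representative hs u ≡ representative hs v → EqClosure (Joined hs) u v
  joined hs {u} {v} e = joined-representative hs u
    ◅◅ subst (λ x → EqClosure (Joined hs) x v) (≡.sym e)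
              (Eq.symmetric (Joined hs) (joined-representative hs v))

  -- The connected partition of a flat.

  module _ (X : Flat (graphical H)) where
    open Flat X

    rep : Fin n → Fin n
    rep = representative hyperplanes

    -- Equalities along the listed edges propagate along walks. With `≈⇒∈-flat`, the flat is exactly
    -- the set of points constant on the classes of `rep`.
    rep≡⇒≈ : ∀ {p} → points p → ∀ {u v} → rep u ≡ rep v → p u ≈ p v
    rep≡⇒≈ {p} p∈X e = Eq.gfold {S = _≈_} ≈-isEquivalence p
      (λ (_ , h∈hs) → All.lookup (proj₁ isIntersection p∈X) h∈hs) (joined hyperplanes e)

    ≈⇒∈-flat : ∀ {p} → (∀ {u v} → rep u ≡ rep v → p u ≈ p v) → points p
    ≈⇒∈-flat p-const = proj₂ isIntersection (All.tabulate λ {(u , v , a)} h∈hs →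
      p-const (representative-joined hyperplanes (Eq.return (a , h∈hs))))

    -- Distinct components receive distinct natural numbers, so whether another flat contains this
    -- single point already compares the two partitions.
    genericPoint : Vector ℝ n
    genericPoint u = fromℚ (ℕ⇒ℚ (toℕ (rep u)))

    genericPoint∈ : points genericPoint
    genericPoint∈ = ≈⇒∈-flat λ {u} {v} e →
      ≗⇒≈ {genericPoint u} {genericPoint v} (λ _ → cong (ℕ⇒ℚ ∘ toℕ) e)

    genericPoint-separates : ∀ {u v} → genericPoint u ≈ genericPoint v → rep u ≡ rep v
    genericPoint-separates e = Fin.toℕ-injective (fromℕ-injective _ _ e)

    -- Steps along listed edges preserve `rep`, so a walk that starts in a union of `rep` classes
    -- never leaves it.
    walk-within : ∀ {B} → (∀ {u v} → rep u ≡ rep v → u ∈ B → v ∈ B) →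
                  ∀ {u v} → EqClosure (Joined hyperplanes) u v → u ∈ B →
                  Star (λ a b → a ∈ B × b ∈ B × Adj a b) u v
    walk-within closed Star.ε     u∈B = Star.ε
    walk-within closed (s ◅ walk) u∈B =
      (u∈B , w∈B , adjacent s) ◅ walk-within closed walk w∈B
      where
      w∈B = closed (representative-joined hyperplanes (s ◅ Star.ε)) u∈B

      adjacent : ∀ {a b} → SymClosure (Joined hyperplanes) a b → Adj a b
      adjacent (fwd (e , _)) = e
      adjacent (bwd (e , _)) = symm e

    components : BondPartition H
    components = record
      { partition = record
        -- Blocks range over the fibers through a vertex, since the fiber over an arbitrary label
        -- may be empty.
        { IsBlock  = λ B → ∃[ v ] B ≡ fiber rep (rep v)
        ; nonempty = λ { (v , refl) → v , ∈-fiber⁺ rep refl }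
        ; covers   = λ v → fiber rep (rep v) , (v , refl) , ∈-fiber⁺ rep refl
        ; disjoint = λ { (u , refl) (v , refl) w∈B w∈C →
            cong (fiber rep) (≡.trans (≡.sym (∈-fiber⁻ rep w∈B)) (∈-fiber⁻ rep w∈C)) }
        }
      ; connected = λ { (w , refl) u∈B v∈B → walk-within
          (λ e a∈B → ∈-fiber⁺ rep (≡.trans (≡.sym e) (∈-fiber⁻ rep a∈B)))
          (joined hyperplanes (≡.trans (∈-fiber⁻ rep u∈B) (≡.sym (∈-fiber⁻ rep v∈B)))) u∈B }
      }

  open Poset (ℒ (graphical H)) using () renaming (_≤_ to _≤ᶠ_)
  open Poset (bondLattice H) using () renaming (_≤_ to _≤ᵇ_; _≈_ to _≈ᵇ_)

  -- `X ≤ᶠ Y` puts the generic point of `Y` into `X`. It is then constant on the components of `X`,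
  -- while separating those of `Y`.
  components-mono : ∀ X Y → X ≤ᶠ Y → components X ≤ᵇ components Y
  components-mono X Y Y⊆X (v , refl) = fiber (rep Y) (rep Y v) , (v , refl) ,
    λ w∈B → ∈-fiber⁺ (rep Y) (genericPoint-separates Y
      (rep≡⇒≈ X (Y⊆X (genericPoint∈ Y)) (∈-fiber⁻ (rep X) w∈B)))

  -- A point of `Y` is constant on the components of `Y`, hence on the smaller components of `X`.
  components-cancel : ∀ X Y → components X ≤ᵇ components Y → X ≤ᶠ Y
  components-cancel X Y X≤Y p∈Y = ≈⇒∈-flat X λ {u} {v} e → rep≡⇒≈ Y p∈Y (rep-coarser e)
    where
    rep-coarser : ∀ {u v} → rep X u ≡ rep X v → rep Y u ≡ rep Y v
    rep-coarser {v = v} e with X≤Y (v , refl)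
    ... | _ , (_ , refl) , B⊆C = ≡.trans
      (∈-fiber⁻ (rep Y) (B⊆C (∈-fiber⁺ (rep X) e)))
      (≡.sym (∈-fiber⁻ (rep Y) (B⊆C (∈-fiber⁺ (rep X) refl))))

  -- The flat of a connected partition.

  module _ (π : BondPartition H) where
    open BondPartition π

    block : Fin n → Subset n
    block v = proj₁ (covers v)

    block-isBlock : ∀ v → IsBlock (block v)
    block-isBlock v = proj₁ (proj₂ (covers v))

    ∈-block : ∀ v → v ∈ block v
    ∈-block v = proj₂ (proj₂ (covers v))

    block-unique : ∀ {B v} → IsBlock B → v ∈ B → block v ≡ B
    block-unique {v = v} isB v∈B = disjoint (block-isBlock v) isB (∈-block v) v∈B

    -- `IsBlock` is an arbitrary predicate, but the blocks chosen by `covers` are Boolean vectors;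
    -- comparing these makes lying in a common block decidable.
    Within : Rel (Fin n) 0ℓ
    Within u v = Adj u v × block u ≡ block v

    within? : Decidable Within
    within? u v = adj? u v ×-dec Vec.≡-dec Bool._≟_ (block u) (block v)

    innerEdges : List Index
    innerEdges = map (λ (u , v , a , _) → u , v , a) (edges within?)

    flat : Flat (graphical H)
    flat = record
      { points         = ⋂ (graphical H) innerEdges
      ; hyperplanes    = innerEdges
      ; isIntersection = (λ p∈ → p∈) , (λ p∈ → p∈)
      -- The zero vector lies on every hyperplane of a graphical arrangement.
      ; nonempty       = (λ _ → 0ℝ) , All.universal (λ _ → ≈-refl {0ℝ}) innerEdges
      }

    rep≡⇒block≡ : ∀ {u v} → rep flat u ≡ rep flat v → block u ≡ block v
    rep≡⇒block≡ e = Eq.gfold ≡.isEquivalence block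
      (λ (_ , h∈hs) → All.lookup sameBlock h∈hs) (joined innerEdges e)
      where
      sameBlock : All (λ (u , v , _) → block u ≡ block v) innerEdges
      sameBlock = All.map⁺ (All.universal (λ (_ , _ , _ , e) → e) (edges within?))

    -- Connectedness of the blocks enters here: a walk inside a block consists of inner edges.
    block≡⇒rep≡ : ∀ {u v} → block u ≡ block v → rep flat u ≡ rep flat v
    block≡⇒rep≡ {u} {v} e = representative-joined innerEdges
      (Star.map step (connected (block-isBlock v) (subst (u ∈_) e (∈-block u)) (∈-block v)))
      where
      step : ∀ {a b} → a ∈ block v × b ∈ block v × Adj a b →
             SymClosure (Joined innerEdges) a b
      step (a∈ , b∈ , adj) =
        let (adj′ , _) , e∈ = ∈-edges within? (adj , ≡.trans
              (block-unique (block-isBlock v) a∈) (≡.sym (block-unique (block-isBlock v) b∈)))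
        in fwd (adj′ , ∈-map⁺ _ e∈)

    block≡fiber : ∀ {B v} → IsBlock B → v ∈ B → B ≡ fiber (rep flat) (rep flat v)
    block≡fiber {B} {v} isB v∈B = ⊆-antisym
      (λ w∈B → ∈-fiber⁺ (rep flat)
        (block≡⇒rep≡ (≡.trans (block-unique isB w∈B) (≡.sym (block-unique isB v∈B)))))
      (λ {w} w∈F → subst (w ∈_)
        (≡.trans (rep≡⇒block≡ (∈-fiber⁻ (rep flat) w∈F)) (block-unique isB v∈B)) (∈-block w))

    components-flat : components flat ≈ᵇ π
    components-flat B = mk⇔
      (λ { (v , refl) → subst IsBlock (block≡fiber (block-isBlock v) (∈-block v))
                          (block-isBlock v) })
      (λ isB → let v , v∈B = nonempty isB in v , block≡fiber isB v∈B)

  ℒ≅bondLattice : ℒ (graphical H) ≅ bondLattice H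
  ℒ≅bondLattice = orderIso (ℒ (graphical H)) (bondLattice H) components
    components-mono components-cancel (λ π → flat π , components-flat π)

-- The coordinates of the Shi arrangement as vertices of Γ G

data Halved : ℕ → Set where
  double    : ∀ k → Halved (2 ℕ.* k)
  1+double  : ∀ k → Halved (suc (2 ℕ.* k))

halve : ∀ k → Halved k
halve zero = double 0
halve (suc k) with halve k
... | double j   = 1+double j
... | 1+double j = subst Halved (ℕ.*-suc 2 j) (double (suc j))

-- With n = m + 1 as a successor, `n ∸ 1` computes to `m` and `dim n` to `suc (m + m)`.
module ShiCoordinates (m : ℕ) where
  n : ℕ
  n = suc m

  private
    m+m≡2*m : m ℕ.+ m ≡ 2 ℕ.* m
    m+m≡2*m = cong (m ℕ.+_) (≡.sym (ℕ.+-identityʳ m))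

    2*k<dim : ∀ {k} → k ℕ.< n → 2 ℕ.* k ℕ.< dim n
    2*k<dim {k} k<n = s≤s (subst (2 ℕ.* k ℕ.≤_) (≡.sym m+m≡2*m) (ℕ.*-monoʳ-≤ 2 (s≤s⁻¹ k<n)))

    1+2*k<dim : ∀ {k} → k ℕ.< m → suc (2 ℕ.* k) ℕ.< dim n
    1+2*k<dim {k} k<m = s≤s (subst (2 ℕ.* k ℕ.<_) (≡.sym m+m≡2*m) (ℕ.*-monoʳ-< 2 k<m))

  abstract
    -- For 1-based i, `opposite` is n - i on `Fin n` and n - 1 - i on `Fin m`. Labels exceed `toℕ`
    -- by one, so they are 2n - 2i + 1 for `xVertex` and 2n - 2i for `yVertex`.
    xVertex : Fin n → Fin (dim n)
    xVertex i = fromℕ< (2*k<dim (Fin.toℕ<n (opposite i)))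

    yVertex : Fin m → Fin (dim n)
    yVertex i = fromℕ< (1+2*k<dim (Fin.toℕ<n (opposite i)))

    toℕ-xVertex : ∀ i → toℕ (xVertex i) ≡ 2 ℕ.* toℕ (opposite i)
    toℕ-xVertex i = Fin.toℕ-fromℕ< (2*k<dim (Fin.toℕ<n (opposite i)))

    toℕ-yVertex : ∀ i → toℕ (yVertex i) ≡ suc (2 ℕ.* toℕ (opposite i))
    toℕ-yVertex i = Fin.toℕ-fromℕ< (1+2*k<dim (Fin.toℕ<n (opposite i)))

  opposite-injective : ∀ {k} {i j : Fin k} → toℕ (opposite i) ≡ toℕ (opposite j) → i ≡ j
  opposite-injective {i = i} {j} e = ≡.trans (≡.sym (Fin.opposite-involutive i))
    (≡.trans (cong opposite (Fin.toℕ-injective e)) (Fin.opposite-involutive j))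

  xVertex-injective : ∀ {i j} → xVertex i ≡ xVertex j → i ≡ j
  xVertex-injective {i} {j} e = opposite-injective (ℕ.*-cancelˡ-≡ _ _ 2
    (≡.trans (≡.sym (toℕ-xVertex i)) (≡.trans (cong toℕ e) (toℕ-xVertex j))))

  yVertex-injective : ∀ {i j} → yVertex i ≡ yVertex j → i ≡ j
  yVertex-injective {i} {j} e = opposite-injective (ℕ.*-cancelˡ-≡ _ _ 2 (ℕ.suc-injective
    (≡.trans (≡.sym (toℕ-yVertex i)) (≡.trans (cong toℕ e) (toℕ-yVertex j)))))

  xVertex≢yVertex : ∀ {i j} → xVertex i ≢ yVertex j
  xVertex≢yVertex {i} {j} e = ℕ.even≢odd (toℕ (opposite i)) (toℕ (opposite j))
    (≡.trans (≡.sym (toℕ-xVertex i)) (≡.trans (cong toℕ e) (toℕ-yVertex j)))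

  data Vertex (v : Fin (dim n)) : Set where
    isX : ∀ i → v ≡ xVertex i → Vertex v
    isY : ∀ i → v ≡ yVertex i → Vertex v

  private
    opposite-fromℕ< : ∀ {j k} .(j<k : j ℕ.< k) → toℕ (opposite (opposite (fromℕ< j<k))) ≡ j
    opposite-fromℕ< j<k = ≡.trans (cong toℕ (Fin.opposite-involutive (fromℕ< j<k))) (Fin.toℕ-fromℕ< j<k)

    -- Even values of `toℕ` are odd labels, hence x-vertices. From 2j < 2m + 1 follows j ≤ m, and
    -- from 2j + 1 < 2m + 1 follows j < m: the ranges of the two families.
    classifyℕ : ∀ v {k} → toℕ v ≡ k → Halved k → Vertex v
    classifyℕ v e (double j) = isX i (Fin.toℕ-injective
      (≡.trans e (≡.sym (≡.trans (toℕ-xVertex i) (cong (2 ℕ.*_) (opposite-fromℕ< j<n))))))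
      where
      j<n : j ℕ.< n
      j<n = s≤s (ℕ.*-cancelˡ-≤ 2 (subst (2 ℕ.* j ℕ.≤_) m+m≡2*m
        (s≤s⁻¹ (subst (ℕ._< dim n) e (Fin.toℕ<n v)))))
      i : Fin n
      i = opposite (fromℕ< j<n)
    classifyℕ v e (1+double j) = isY i (Fin.toℕ-injective
      (≡.trans e (≡.sym (≡.trans (toℕ-yVertex i)
        (cong (λ k → suc (2 ℕ.* k)) (opposite-fromℕ< j<m))))))
      where
      j<m : j ℕ.< m
      j<m = ℕ.*-cancelˡ-< 2 j m (subst (2 ℕ.* j ℕ.<_) m+m≡2*m
        (s≤s⁻¹ (subst (ℕ._< dim n) e (Fin.toℕ<n v))))
      i : Fin m
      i = opposite (fromℕ< j<m)

  abstract
    classify : ∀ v → Vertex v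
    classify v = classifyℕ v refl (halve (toℕ v))

  coordinate : Vector ℝ (dim n) → ∀ {v} → Vertex v → ℝ
  coordinate p (isX i _) = xᶜ n p i
  coordinate p (isY i _) = xᶜ n p (widen n i) - yᶜ n p i

  φ : Vector ℝ (dim n) → Vector ℝ (dim n)
  φ p v = coordinate p (classify v)

  -- Since `xVertex` is injective and never meets `yVertex`, every classification `t` gives the same
  -- value; `classify` need not be evaluated.
  coordinate-xVertex : ∀ p {v i} (t : Vertex v) → v ≡ xVertex i → coordinate p t ≡ xᶜ n p i
  coordinate-xVertex p (isX j refl) e = cong (xᶜ n p) (xVertex-injective e)
  coordinate-xVertex p (isY j refl) e = ⊥-elim (xVertex≢yVertex (≡.sym e))

  coordinate-yVertex : ∀ p {v i} (t : Vertex v) → v ≡ yVertex i →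
                       coordinate p t ≡ xᶜ n p (widen n i) - yᶜ n p i
  coordinate-yVertex p (isX j refl) e = ⊥-elim (xVertex≢yVertex e)
  coordinate-yVertex p (isY j refl) e =
    cong (λ k → xᶜ n p (widen n k) - yᶜ n p k) (yVertex-injective e)

  φ-xVertex : ∀ p i → φ p (xVertex i) ≡ xᶜ n p i
  φ-xVertex p i = coordinate-xVertex p (classify (xVertex i)) refl

  φ-yVertex : ∀ p i → φ p (yVertex i) ≡ xᶜ n p (widen n i) - yᶜ n p i
  φ-yVertex p i = coordinate-yVertex p (classify (yVertex i)) refl

  ψ-component : Vector ℝ (dim n) → Fin n ⊎ Fin m → ℝ
  ψ-component z (inj₁ i) = z (xVertex i)
  ψ-component z (inj₂ i) = z (xVertex (widen n i)) - z (yVertex i)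

  ψ : Vector ℝ (dim n) → Vector ℝ (dim n)
  ψ z c = ψ-component z (splitAt n c)

  xᶜ-ψ : ∀ z i → xᶜ n (ψ z) i ≡ z (xVertex i)
  xᶜ-ψ z i = cong (ψ-component z) (Fin.splitAt-↑ˡ n i m)

  yᶜ-ψ : ∀ z i → yᶜ n (ψ z) i ≡ z (xVertex (widen n i)) - z (yVertex i)
  yᶜ-ψ z i = cong (ψ-component z) (Fin.splitAt-↑ʳ n m i)

  -- Settles the y-part of both `φψ` and `ψφ`, as `φ` and `ψ` each subtract from the same
  -- x-coordinate.
  x-[x-y]≈y : ∀ x y {a b} → a ≡ x → b ≡ x - y → a - b ≈ y
  x-[x-y]≈y x y refl refl = x//[x//y]≈y x y

  coordinate-ψ : ∀ z {v} (t : Vertex v) → coordinate (ψ z) t ≈ z v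
  coordinate-ψ z (isX i refl) = ≡⇒≈ {xᶜ n (ψ z) i} {z (xVertex i)} (xᶜ-ψ z i)
  coordinate-ψ z (isY i refl) = x-[x-y]≈y (z (xVertex (widen n i))) (z (yVertex i))
    {xᶜ n (ψ z) (widen n i)} {yᶜ n (ψ z) i} (xᶜ-ψ z (widen n i)) (yᶜ-ψ z i)

  φψ : ∀ z → φ (ψ z) ≈ᵛ z
  φψ z v = coordinate-ψ z (classify v)

  xᶜ-ψφ : ∀ p i → xᶜ n (ψ (φ p)) i ≈ xᶜ n p i
  xᶜ-ψφ p i = ≡⇒≈ {xᶜ n (ψ (φ p)) i} {xᶜ n p i} (≡.trans (xᶜ-ψ (φ p) i) (φ-xVertex p i))

  yᶜ-ψφ : ∀ p i → yᶜ n (ψ (φ p)) i ≈ yᶜ n p i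
  yᶜ-ψφ p i = ≈-resp-≡ {φ p (xVertex (widen n i)) - φ p (yVertex i)} {yᶜ n (ψ (φ p)) i}
    {yᶜ n p i} {yᶜ n p i} (≡.sym (yᶜ-ψ (φ p) i)) refl
    (x-[x-y]≈y (xᶜ n p (widen n i)) (yᶜ n p i) {φ p (xVertex (widen n i))} {φ p (yVertex i)}
      (φ-xVertex p (widen n i)) (φ-yVertex p i))

  ψφ : ∀ p → ψ (φ p) ≈ᵛ p
  ψφ p c = subst (λ c → ψ (φ p) c ≈ p c) (Fin.join-splitAt n m c) (at-join (splitAt n c))
    where
    at-join : ∀ s → ψ (φ p) (Fin.join n m s) ≈ p (Fin.join n m s)
    at-join (inj₁ i) = xᶜ-ψφ p i
    at-join (inj₂ i) = yᶜ-ψφ p i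

  label-injective : ∀ {u v : Fin (dim n)} → label u ≡ label v → u ≡ v
  label-injective e = Fin.toℕ-injective (ℕ.suc-injective e)

  label-xVertex : ∀ i → label (xVertex i) ≡ 2 ℕ.* n ℕ.∸ 2 ℕ.* label i ℕ.+ 1
  label-xVertex i = begin
    suc (toℕ (xVertex i))               ≡⟨ cong suc (toℕ-xVertex i) ⟩
    suc (2 ℕ.* toℕ (opposite i))        ≡⟨ cong (λ k → suc (2 ℕ.* k)) (Fin.opposite-prop i) ⟩
    suc (2 ℕ.* (n ℕ.∸ label i))         ≡⟨ cong suc (ℕ.*-distribˡ-∸ 2 n (label i)) ⟩
    suc (2 ℕ.* n ℕ.∸ 2 ℕ.* label i)     ≡⟨ ℕ.+-comm 1 _ ⟩
    2 ℕ.* n ℕ.∸ 2 ℕ.* label i ℕ.+ 1     ∎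
    where open ≡.≡-Reasoning

  -- The form required by `odd-even`: in 1-based terms xᵢ is the odd vertex of index n + 1 - i,
  -- while yᵢ is the even vertex of index n - i.
  label-xVertex′ : ∀ {i k} → toℕ (opposite i) ≡ k → label (xVertex i) ≡ 2 ℕ.* suc k ℕ.∸ 1
  label-xVertex′ {i} refl = ≡.trans (cong suc (toℕ-xVertex i)) (≡.sym (ℕ.+-suc _ _))

  label-yVertex : ∀ {i k} → toℕ (opposite i) ≡ k → label (yVertex i) ≡ 2 ℕ.* suc k
  label-yVertex {i} refl = ≡.trans (cong suc (toℕ-yVertex i)) (≡.sym (ℕ.*-suc 2 _))

  toℕ-opposite² : ∀ {k} (i : Fin k) → toℕ (opposite (opposite i)) ≡ toℕ i
  toℕ-opposite² i = cong toℕ (Fin.opposite-involutive i)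

  toℕ-widen : ∀ i → toℕ (widen n i) ≡ toℕ i
  toℕ-widen i = Fin.toℕ-inject≤ i _

  -- Hyperplanes of the Shi arrangement and edges of `Γ G`.

  module _ (G : Graph n) where
    open Graph G
    open Arrangement (ℋ G) using (hyperplane)

    ℋ-ext : ExtensionalArrangement (ℋ G)
    ℋ-ext (edge i j _ _) {p} {q} p≈q = //-resp-≈
      {xᶜ n p i} {xᶜ n q i} {xᶜ n p j} {xᶜ n q j} {0ℝ} {0ℝ}
      (p≈q (i ↑ˡ m)) (p≈q (j ↑ˡ m)) (≈-refl {0ℝ})
    ℋ-ext (shi i j _) {p} {q} p≈q = //-resp-≈
      {xᶜ n p (widen n i)} {xᶜ n q (widen n i)} {xᶜ n p j} {xᶜ n q j} {yᶜ n p i} {yᶜ n q i}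
      (p≈q (widen n i ↑ˡ m)) (p≈q (j ↑ˡ m)) (p≈q (n ↑ʳ i))

    open ChangeOfCoordinates (ℋ G) (graphical (Γ G)) ℋ-ext (graphical-ext (Γ G)) φ ψ φψ ψφ

    swap : ∀ {A : Set} {x y : ℝ} → A ⇔ (x ≈ y) → A ⇔ (y ≈ x)
    swap {x = x} {y} e = mk⇔ (≈-sym {x} {y} ∘ to) (from ∘ ≈-sym {y} {x})
      where open Equivalence e

    ⇔-resp-≡ : ∀ {A : Set} {x x′ y y′} → x ≡ x′ → y ≡ y′ → A ⇔ (x ≈ y) → A ⇔ (x′ ≈ y′)
    ⇔-resp-≡ refl refl e = e

    edge-corresponds : ∀ i j i<j a p →
      hyperplane (edge i j i<j a) p ⇔ φ p (xVertex i) ≈ φ p (xVertex j)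
    edge-corresponds i j _ _ p = ⇔-resp-≡
      {x′ = φ p (xVertex i)} {y′ = φ p (xVertex j)}
      (≡.sym (φ-xVertex p i)) (≡.sym (φ-xVertex p j)) (x//y≈ε⇔x≈y (xᶜ n p i) (xᶜ n p j))

    shi-corresponds : ∀ i j i<j p →
      hyperplane (shi i j i<j) p ⇔ φ p (yVertex i) ≈ φ p (xVertex j)
    shi-corresponds i j _ p = ⇔-resp-≡
      {x′ = φ p (yVertex i)} {y′ = φ p (xVertex j)}
      (≡.sym (φ-yVertex p i)) (≡.sym (φ-xVertex p j)) (x//y≈z⇔x//z≈y (xᶜ n p (widen n i)) (xᶜ n p j) (yᶜ n p i))

    image : ∀ h → ∃[ k ] Corresponds h k
    image h@(edge i j i<j a) =
      (xVertex i , xVertex j , fwd (odd-odd i j a (label-xVertex i) (label-xVertex j)))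
      , edge-corresponds i j i<j a
    image h@(shi i j i<j) =
      -- `odd-even` runs from the x-vertex to the y-vertex, hence `bwd`. `opposite j` lives in
      -- `Fin n` and is moved to `Fin m`, where i < j guarantees that it fits.
      (yVertex i , xVertex j , bwd (odd-even (fromℕ< j′<m) (opposite i)
        (subst (ℕ._≤ toℕ (opposite i)) (≡.sym (Fin.toℕ-fromℕ< j′<m)) j′≤i′)
        (label-xVertex′ (≡.sym (Fin.toℕ-fromℕ< j′<m))) (label-yVertex refl)))
      , shi-corresponds i j i<j
      where
      j′≤i′ : toℕ (opposite j) ℕ.≤ toℕ (opposite i)
      -- On 0-based values the opposites are m - j and m - (i + 1), taken in `Fin n` and `Fin m`;
      -- this shift turns i < j into a weak inequality.
      j′≤i′ = ≡.subst₂ ℕ._≤_ (≡.sym (Fin.opposite-prop j)) (≡.sym (Fin.opposite-prop i))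
        (ℕ.∸-monoʳ-≤ m (subst (ℕ._< toℕ j) (toℕ-widen i) i<j))
      j′<m : toℕ (opposite j) ℕ.< m
      j′<m = ℕ.≤-<-trans j′≤i′ (Fin.toℕ<n (opposite i))

    preimageΓEdge : ∀ {u v} → ΓEdge G u v →
      ∃[ h ] ∀ p → hyperplane h p ⇔ φ p u ≈ φ p v
    preimageΓEdge (odd-odd i j a u≡ v≡)
      rewrite label-injective (≡.trans u≡ (≡.sym (label-xVertex i)))
            | label-injective (≡.trans v≡ (≡.sym (label-xVertex j)))
      -- `odd-odd` admits each edge of `G` in both orders, `edge` only with the smaller index first.
      with Fin.<-cmp i j
    ... | tri< i<j _ _  = edge i j i<j a , edge-corresponds i j i<j a
    ... | tri≈ _ i≡j _  = ⊥-elim (irrefl i≡j a)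
    ... | tri> _ _ j<i  = edge j i j<i (symm a) , λ p →
      swap {x = φ p (xVertex j)} {φ p (xVertex i)} (edge-corresponds j i j<i (symm a) p)
    preimageΓEdge (odd-even i j i≤j u≡ v≡)
      rewrite label-injective (≡.trans u≡ (≡.sym (label-xVertex′ {opposite (widen n i)}
                (≡.trans (toℕ-opposite² (widen n i)) (toℕ-widen i)))))
            | label-injective (≡.trans v≡ (≡.sym (label-yVertex {opposite j} (toℕ-opposite² j))))
      -- This inverts the reindexing in `image`: 1-based, even index j returns y with index n - j
      -- and odd index i returns x with index n + 1 - i.
      = shi (opposite j) (opposite (widen n i)) j′<i′ , λ p →
          swap {x = φ p (yVertex (opposite j))} {φ p (xVertex (opposite (widen n i)))}
            (shi-corresponds (opposite j) (opposite (widen n i)) j′<i′ p)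
      where
      j′<i′ : widen n (opposite j) Fin.< opposite (widen n i)
      j′<i′ = ≡.subst₂ ℕ._<_
        (≡.sym (≡.trans (toℕ-widen (opposite j)) (Fin.opposite-prop j)))
        (≡.sym (≡.trans (Fin.opposite-prop (widen n i)) (cong (m ℕ.∸_) (toℕ-widen i))))
        -- The claim is m - (j + 1) < m - i on 0-based values; it is strict because j + 1 ≤ m keeps
        -- the subtraction from truncating.
        (ℕ.∸-monoʳ-< (s≤s i≤j) (Fin.toℕ<n j))

    preimage : ∀ k → ∃[ h ] Corresponds h k
    preimage (u , v , fwd e) = preimageΓEdge e
    preimage (u , v , bwd e) = let h , c = preimageΓEdge e in
      h , λ p → swap {x = φ p v} {φ p u} (c p)

    ℒℋ≅ℒgraphical : ℒ (ℋ G) ≅ ℒ (graphical (Γ G))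
    ℒℋ≅ℒgraphical = ℒ-iso image preimage

theorem3p1 : (n : ℕ) → n ≥ 1 → (G : Graph n) →
    (ℒ (ℋ G) ≅ ℒ (graphical (Γ G))) × (ℒ (graphical (Γ G)) ≅ bondLattice (Γ G))
theorem3p1 (suc m) _ G = ShiCoordinates.ℒℋ≅ℒgraphical m G , GraphicalFlats.ℒ≅bondLattice (Γ G)
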